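{- There exists a sentence $\theta$ of the logic ${\cal R}ing(0,+,*,<)+MOD+M$ such that its prime spectrum $Sp(\theta)$ has no exponential density, i.e. the limit $\lim_{n\to\infty}\log(\pi_{Sp(\theta)}(n))/\log(\pi(n))$ does not exist.
   Context: For an integer $m\ge 1$, $\mathbb{Z}_m$ denotes the finite residue class ring with universe $\{0,1,\ldots,m-1\}$, addition and multiplication modulo $m$. The logic ${\cal R}ing(0,+,*,<)$ consists of first-order formulas over a constant symbol $0$, binary function symbols $+,*$ and a binary relation symbol $<$; its models are the rings $\mathbb{Z}_m$, with $0$ the residue class $0$, $+,*$ addition and multiplication mod $m$, and $<$ the natural order of the representatives $0<1<\cdots<m-1$. The logic ${\cal R}ing(0,+,*,<)+MOD+M$ is the smallest extension of it closed under the usual first-order constructions and additionally under: (i) modular quantifiers $\exists^{(r,q)}z$ for all integers $q>0$ and $0\le r<q$, where $\mathbb{Z}_m\models\exists^{(r,q)}z\,\phi(\bar a,z)$ iff the number of $z\in\mathbb{Z}_m$ with $\mathbb{Z}_m\models\phi(\bar a,z)$ is congruent to $r$ modulo $q$; (ii) the majority quantifier $Mz$, where $\mathbb{Z}_m\models Mz\,\phi(\bar a,z)$ iff $\phi(\bar a,z)$ holds for more than half of the elements $z\in\mathbb{Z}_m$. The prime spectrum of a sentence $\sigma$ is $Sp(\sigma)=\{p\text{ prime}:\mathbb{Z}_p\models\sigma\}$. For real $x>0$, $\pi(x)$ is the number of primes $\le x$ and, for a set $S$ of primes, $\pi_S(x)=|\{q\in S:q\le x\}|$. $S$ has exponential density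 if $\lim_{n\to\infty}\log(\pi_S(n))/\log(\pi(n))$ (over natural numbers $n$) exists. -}

module Defs where

open import Data.Nat using (ℕ; zero; suc; _+_; _*_; _^_; _<_; _≤_; _<ᵇ_; _≡ᵇ_)
open import Data.Nat.DivMod using (_%_)
open import Data.Nat.Primality using (prime?)
open import Data.Bool using (Bool; true; false; not; _∧_; _∨_)
open import Data.Fin using (Fin)
open import Data.Vec using (Vec; _∷_; lookup)
open import Data.List using (List; upTo; filterᵇ; length)
open import Data.Bool.ListAction using (all; any)
open import Relation.Nullary.Decidable using (⌊_⌋)
open import Relation.Binary.PropositionalEquality using (_≡_)
open import Data.Product using (Σ; _×_; ∃-syntax)

data Term (n : ℕ) : Set where
  var  : Fin n → Term n
  zer  : Term n
  _⊕_  : Term n → Term n → Term n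
  _⊛_  : Term n → Term n → Term n

data Formula (n : ℕ) : Set where
  _≐_   : Term n → Term n → Formula n
  _≺_   : Term n → Term n → Formula n
  ⊤f ⊥f : Formula n
  ¬f_   : Formula n → Formula n
  _∧f_  : Formula n → Formula n → Formula n
  _∨f_  : Formula n → Formula n → Formula n
  _⇒f_  : Formula n → Formula n → Formula n
  ∃f    : Formula (suc n) → Formula n
  ∀f    : Formula (suc n) → Formula n
  ∃mod  : (r q : ℕ) → r < q → Formula (suc n) → Formula n
  Maj   : Formula (suc n) → Formula n

Sentence : Set
Sentence = Formula 0

-- Semantics in Z_m with m = suc k; elements are represented by 0,1,…,k.
module _ (k : ℕ) where
  private
    m : ℕ
    m = suc k

  evalT : ∀ {n} → Vec ℕ n → Term n → ℕ
  evalT ρ (var i) = lookup ρ i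
  evalT ρ zer     = 0
  evalT ρ (s ⊕ t) = (evalT ρ s + evalT ρ t) % m
  evalT ρ (s ⊛ t) = (evalT ρ s * evalT ρ t) % m

  count : (ℕ → Bool) → ℕ
  count P = length (filterᵇ P (upTo m))

  eval : ∀ {n} → Vec ℕ n → Formula n → Bool
  eval ρ (s ≐ t) = evalT ρ s ≡ᵇ evalT ρ t
  eval ρ (s ≺ t) = evalT ρ s <ᵇ evalT ρ t
  eval ρ ⊤f = true
  eval ρ ⊥f = false
  eval ρ (¬f φ) = not (eval ρ φ)
  eval ρ (φ ∧f ψ) = eval ρ φ ∧ eval ρ ψ
  eval ρ (φ ∨f ψ) = eval ρ φ ∨ eval ρ ψ
  eval ρ (φ ⇒f ψ) = not (eval ρ φ) ∨ eval ρ ψ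
  eval ρ (∃f φ) = any (λ z → eval (z ∷ ρ) φ) (upTo m)
  eval ρ (∀f φ) = all (λ z → eval (z ∷ ρ) φ) (upTo m)
  eval ρ (∃mod r (suc q) _ φ) = (count (λ z → eval (z ∷ ρ) φ) % suc q) ≡ᵇ r
  eval ρ (Maj φ) = m <ᵇ (2 * count (λ z → eval (z ∷ ρ) φ))

-- Z_m ⊨ σ (for m ≥ 1; Z_0 is not a model, so we return false there).
Sat : ℕ → Sentence → Bool
Sat zero    σ = false
Sat (suc k) σ = eval k Data.Vec.[] σ

inSp : Sentence → ℕ → Bool
inSp σ p = ⌊ prime? p ⌋ ∧ Sat p σ

πf : ℕ → ℕ
πf x = length (filterᵇ (λ p → ⌊ prime? p ⌋) (upTo (suc x)))

πSp : Sentence → ℕ → ℕ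
πSp σ x = length (filterᵇ (inSp σ) (upTo (suc x)))

-- For A ≥ 0, B ≥ 2 and a rational a/b (b ≥ 1):
--   log A / log B < a/b  ⇔  A^b < B^a      (log 0 = -∞)
--   log A / log B > a/b  ⇔  B^a < A^b
-- The sequence x_n = log π_S(n) / log π(n) has NO limit iff it oscillates:
-- there are nonnegative rationals a₁/b₁ < a₂/b₂ such that infinitely often
-- x_n < a₁/b₁ and infinitely often x_n > a₂/b₂.
NoExponentialDensity : Sentence → Set
NoExponentialDensity σ =
  ∃[ a₁ ] ∃[ b₁ ] ∃[ a₂ ] ∃[ b₂ ]
    (1 ≤ b₁) × (1 ≤ b₂) × (a₁ * b₂ < a₂ * b₁) ×
    (∀ N → ∃[ n ] (N ≤ n × 2 ≤ πf n × πSp σ n ^ b₁ < πf n ^ a₁)) ×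
    (∀ N → ∃[ n ] (N ≤ n × 2 ≤ πf n × πf n ^ a₂ < πSp σ n ^ b₂))

{-# OPTIONS --safe #-}
-- The numbers 2^(2^j) are first-order definable without coding sequences: n = 2^b is such a number
-- iff no 2^a + 1 with 1 ≤ a < b divides n + 1, because 2^a + 1 ∣ 2^b + 1 iff b is an odd multiple of a.
-- The sentence θ says that the number of z = 2^(2^j) with z² < p is divisible by 3. For primes p
-- in the block 2^(2^J) < p ≤ 2^(2^(J+1)) this number is J, so θ selects every third block. Since the
-- end of a block is the square of its beginning, and π(x) > 2√x (Nair's proof of Chebyshev's bound)
-- at these ends, the spectrum contains more than half of all primes up to the end of a selected
-- block, but fewer than √π(x) primes up to the end of the second block after it.
module Submission where

open import Defs
open import Data.Bool using (Bool; true; false; T; not; _∧_; _∨_; if_then_else_)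
open import Data.Bool.ListAction using (all)
open import Data.Bool.Properties using (T-≡; T-∧; T-∨; ∧-zeroʳ)
open import Data.Empty using (⊥; ⊥-elim)
open import Data.Fin using (Fin; zero; suc)
open import Data.List using (length; filterᵇ; upTo; []; _∷_; _++_)
open import Data.List.Membership.Propositional using (_∈_; find; lose)
open import Data.List.Membership.Propositional.Properties using (∈-upTo⁺; ∈-upTo⁻)
open import Data.List.Properties using (upTo-∷ʳ; filter-++; length-++)
open import Data.List.Relation.Unary.All using (_∷_)
open import Data.List.Relation.Unary.Any using (here; there)
open import Data.List.Relation.Unary.Any.Properties using (any⁺; any⁻)
open import Data.Nat
open import Data.Nat.Divisibility
open import Data.Nat.DivMod using (_%_; m<n⇒m%n≡m; m%n≤m; [m+n]%n≡m%n; m*n%n≡0; [m+kn]%n≡m%n)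
open import Data.Nat.ListAction using (product)
open import Data.Nat.Primality using (Prime; prime?; prime⇒nonTrivial; euclidsLemma; prime[2])
open import Data.Nat.Primality.Factorisation using (factorise)
open import Data.Nat.Properties
open import Data.Nat.Tactic.RingSolver using (solve-∀)
import Data.Product as Product
open import Data.Product using (∃-syntax; _×_; _,_; proj₁; proj₂)
import Data.Sum as Sum
open import Data.Sum using (_⊎_; inj₁; inj₂)
open import Data.Unit using (tt)
open import Data.Vec using (Vec; lookup; []; _∷_)
open import Function using (_∘_; Equivalence)
open import Relation.Binary.PropositionalEquality using (_≡_; _≢_; refl; sym; trans; cong; cong₂; subst; module ≡-Reasoning)
open import Relation.Nullary using (¬_; yes; no)
open import Relation.Nullary.Decidable using (⌊_⌋; T?)

-- Counting below a bound

tally : (ℕ → Bool) → ℕ → ℕ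
tally P n = length (filterᵇ P (upTo n))

tally-suc : ∀ P n → tally P (suc n) ≡ tally P n + (if P n then 1 else 0)
tally-suc P n = begin
  length (filterᵇ P (upTo (suc n)))                     ≡⟨ cong (length ∘ filterᵇ P) (upTo-∷ʳ n) ⟨
  length (filterᵇ P (upTo n ++ n ∷ []))                 ≡⟨ cong length (filter-++ (T? ∘ P) (upTo n) (n ∷ [])) ⟩
  length (filterᵇ P (upTo n) ++ filterᵇ P (n ∷ []))     ≡⟨ length-++ (filterᵇ P (upTo n)) ⟩
  tally P n + length (filterᵇ P (n ∷ []))               ≡⟨ cong (tally P n +_) last ⟩
  tally P n + (if P n then 1 else 0)                    ∎
  where
  open ≡-Reasoning
  last : length (filterᵇ P (n ∷ [])) ≡ (if P n then 1 else 0)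
  last with P n
  ... | true  = refl
  ... | false = refl

tally-true : ∀ P n → P n ≡ true → tally P (suc n) ≡ suc (tally P n)
tally-true P n eq rewrite tally-suc P n | eq = +-comm (tally P n) 1

tally-false : ∀ P n → P n ≡ false → tally P (suc n) ≡ tally P n
tally-false P n eq rewrite tally-suc P n | eq = +-identityʳ (tally P n)

tally-mono : ∀ P {m n} → m ≤ n → tally P m ≤ tally P n
tally-mono P {m} m≤n = go (≤⇒≤′ m≤n)
  where
  go : ∀ {n} → m ≤′ n → tally P m ≤ tally P n
  go ≤′-refl = ≤-refl
  go (≤′-step {n} m≤n) = begin
    tally P m                            ≤⟨ go m≤n ⟩
    tally P n                            ≤⟨ m≤m+n _ _ ⟩
    tally P n + (if P n then 1 else 0)   ≡⟨ tally-suc P n ⟨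
    tally P (suc n)                      ∎
    where open ≤-Reasoning

tally-const : ∀ P {m n} → m ≤ n → (∀ x → m ≤ x → x < n → P x ≡ false) → tally P n ≡ tally P m
tally-const P {m} m≤n = go (≤⇒≤′ m≤n)
  where
  go : ∀ {n} → m ≤′ n → (∀ x → m ≤ x → x < n → P x ≡ false) → tally P n ≡ tally P m
  go ≤′-refl             none = refl
  go (≤′-step {n} m≤n) none =
    trans (tally-false P n (none n (≤′⇒≤ m≤n) ≤-refl)) (go m≤n λ x m≤x x<n → none x m≤x (m<n⇒m<1+n x<n))

-- Numbers below `m` are charged wholesale, so the inclusion is needed only from `m` on. In `dense`
-- this is where a selected block begins.
tally-⊆ : ∀ P Q {m n} → m ≤ n → (∀ x → m ≤ x → x < n → P x ≡ true → Q x ≡ true) →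
          tally P n ≤ tally Q n + tally P m
tally-⊆ P Q {m} m≤n = go (≤⇒≤′ m≤n)
  where
  go : ∀ {n} → m ≤′ n → (∀ x → m ≤ x → x < n → P x ≡ true → Q x ≡ true) → tally P n ≤ tally Q n + tally P m
  go ≤′-refl sub = m≤n+m _ _
  go (≤′-step {n} m≤n) sub with go m≤n (λ x m≤x x<n → sub x m≤x (m<n⇒m<1+n x<n)) | P n in eq
  ... | ih | false = subst (_≤ tally Q (suc n) + tally P m) (sym (tally-false P n eq))
                       (≤-trans ih (+-monoˡ-≤ (tally P m) (tally-mono Q (n≤1+n n))))
  ... | ih | true rewrite tally-true P n eq | tally-true Q n (sub n (≤′⇒≤ m≤n) ≤-refl eq) = s≤s ih

tally≤ : ∀ P n → P 0 ≡ false → tally P (suc n) ≤ n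
tally≤ P zero    P0 = ≤-reflexive (tally-false P 0 P0)
tally≤ P (suc n) P0 with P (suc n) in eq
... | true  rewrite tally-true P (suc n) eq  = s≤s (tally≤ P n P0)
... | false rewrite tally-false P (suc n) eq = m≤n⇒m≤1+n (tally≤ P n P0)

-- A lower bound for π

isPrime : ℕ → Bool
isPrime p = ⌊ prime? p ⌋

n<2^n : ∀ n → n < 2 ^ n
n<2^n zero    = s≤s z≤n
n<2^n (suc n) = begin-strict
  suc n             <⟨ s≤s (n<2^n n) ⟩
  1 + 2 ^ n         ≤⟨ +-monoˡ-≤ (2 ^ n) (m^n>0 2 n) ⟩
  2 ^ n + 2 ^ n     ≡⟨ cong (2 ^ n +_) (+-identityʳ _) ⟨
  2 ^ suc n         ∎
  where open ≤-Reasoning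

largestPower : ∀ {p N} → 2 ≤ p → 1 ≤ N → ∃[ v ] (p ^ v ≤ N × (∀ e → p ^ e ≤ N → e ≤ v))
largestPower {p} {N} 2≤p 1≤N with search N
  where
  search : ∀ k → ∃[ v ] (p ^ v ≤ N × (∀ e → e ≤ k → p ^ e ≤ N → e ≤ v))
  search zero = 0 , 1≤N , λ e e≤0 _ → e≤0
  search (suc k) with p ^ suc k ≤? N
  ... | yes fits = suc k , fits , λ e e≤1+k _ → e≤1+k
  ... | no ¬fits with search k
  ...   | v , pv≤N , max = v , pv≤N , max′
    where
    max′ : ∀ e → e ≤ suc k → p ^ e ≤ N → e ≤ v
    max′ e e≤1+k pe≤N with m≤n⇒m<n∨m≡n e≤1+k
    ... | inj₁ e<1+k = max e (s≤s⁻¹ e<1+k) pe≤N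
    ... | inj₂ refl  = ⊥-elim (¬fits pe≤N)
-- Exponents up to `N` suffice in the search: p ^ e ≤ N forces e < 2 ^ e ≤ N.
... | v , pv≤N , max = v , pv≤N , λ e pe≤N →
        max e (≤-trans (<⇒≤ (n<2^n e)) (≤-trans (^-monoˡ-≤ e 2≤p) pe≤N)) pe≤N

powerPart : ∀ {p} → 2 ≤ p → ∀ m → 1 ≤ m → ∃[ e ] ∃[ m′ ] (m ≡ p ^ e * m′ × ¬ p ∣ m′)
powerPart {p} 2≤p m = go m m ≤-refl
  where
  instance _ = >-nonZero (≤-trans (s≤s z≤n) 2≤p)
  go : ∀ fuel m → m ≤ fuel → 1 ≤ m → ∃[ e ] ∃[ m′ ] (m ≡ p ^ e * m′ × ¬ p ∣ m′)
  go zero m m≤0 1≤m = ⊥-elim (<⇒≱ 1≤m m≤0)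
  go (suc fuel) m m≤ 1≤m with p ∣? m
  ... | no p∤m = 0 , m , sym (+-identityʳ m) , p∤m
  ... | yes (divides zero refl) = ⊥-elim (<-irrefl refl 1≤m)
  ... | yes (divides q@(suc _) refl) with go fuel q (s≤s⁻¹ (<-≤-trans q<qp m≤)) (s≤s z≤n)
    where
    q<qp : q < q * p
    q<qp = m<m*n q p 2≤p
  ...   | e , m′ , eq , p∤m′ = suc e , m′ , trans (trans (cong (_* p) eq) (*-comm _ p)) (sym (*-assoc p (p ^ e) m′)) , p∤m′

prime>1 : ∀ {p} → Prime p → 1 < p
prime>1 {p} pr = nonTrivial⇒n>1 p {{prime⇒nonTrivial pr}}

primeFree⇒≡1 : ∀ m → 1 ≤ m → (∀ q → Prime q → ¬ q ∣ m) → m ≡ 1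
primeFree⇒≡1 m@(suc _) _ free with factorise m
... | record { factors = [] ; isFactorisation = eq } = eq
... | record { factors = q ∷ qs ; isFactorisation = eq ; factorsPrime = pr ∷ _ } =
        ⊥-elim (free q pr (subst (q ∣_) (sym eq) (m∣m*n (product qs))))

-- L is the product of the largest powers ≤ N of the primes ≤ i.
smoothMultiple : ∀ N → 1 ≤ N → ∀ i →
  ∃[ L ] (1 ≤ L × L ≤ N ^ πf i × (∀ m → 1 ≤ m → m ≤ N → (∀ q → Prime q → q ∣ m → q ≤ i) → m ∣ L))
smoothMultiple N 1≤N zero = 1 , ≤-refl , ≤-refl , λ m 1≤m _ smooth → ∣-reflexive
  (primeFree⇒≡1 m 1≤m λ q pr q∣m → <⇒≱ (<-trans z<s (prime>1 pr)) (smooth q pr q∣m))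
smoothMultiple N 1≤N (suc i) with smoothMultiple N 1≤N i | prime? (suc i) in isP
... | L , 1≤L , L≤ , mult | no ¬pr = L , 1≤L , subst (λ e → L ≤ N ^ e) (sym (tally-false isPrime (suc i) (cong ⌊_⌋ isP))) L≤ ,
        λ m 1≤m m≤N smooth → mult m 1≤m m≤N λ q pr q∣m → smaller q pr (smooth q pr q∣m)
  where
  smaller : ∀ q → Prime q → q ≤ suc i → q ≤ i
  smaller q pr q≤ with m≤n⇒m<n∨m≡n q≤
  ... | inj₁ q<  = s≤s⁻¹ q<
  ... | inj₂ refl = ⊥-elim (¬pr pr)
... | L , 1≤L , L≤ , mult | yes pr with largestPower (prime>1 pr) 1≤N
...   | v , pv≤N , max = p ^ v * L , *-mono-≤ (m^n>0 p v) 1≤L , bound , mult′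
  where
  p = suc i
  bound : p ^ v * L ≤ N ^ πf p
  bound = subst (λ e → p ^ v * L ≤ N ^ e) (sym (tally-true isPrime p (cong ⌊_⌋ isP))) (*-mono-≤ pv≤N L≤)
  mult′ : ∀ m → 1 ≤ m → m ≤ N → (∀ q → Prime q → q ∣ m → q ≤ p) → m ∣ p ^ v * L
  mult′ m 1≤m m≤N smooth with powerPart (prime>1 pr) m 1≤m
  ... | e , zero , refl , _ = ⊥-elim (<-irrefl (sym (*-zeroʳ (p ^ e))) 1≤m)
  -- `p ^ e` divides `p ^ v` by maximality of `v`, and the cofactor `m′` has only prime divisors ≤
  -- `i`.
  ... | e , m′@(suc _) , refl , p∤m′ = *-pres-∣
          (subst (λ w → p ^ e ∣ p ^ w) (m+[n∸m]≡n e≤v) (subst (p ^ e ∣_) (sym (^-distribˡ-+-* p e (v ∸ e))) (m∣m*n _)))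
          (mult m′ (s≤s z≤n) (≤-trans (m≤n*m m′ (p ^ e) {{m^n≢0 p e}}) m≤N) smooth′)
    where
    e≤v : e ≤ v
    e≤v = max e (≤-trans (m≤m*n (p ^ e) m′) m≤N)
    smooth′ : ∀ q → Prime q → q ∣ m′ → q ≤ i
    smooth′ q prq q∣m′ with m≤n⇒m<n∨m≡n (smooth q prq (∣n⇒∣m*n (p ^ e) q∣m′))
    ... | inj₁ q<   = s≤s⁻¹ q<
    ... | inj₂ refl = ⊥-elim (p∤m′ q∣m′)

-- Integrality of L ∫₀¹ xᵃ(1−x)ᵇ dx = L a! b! / (a+b+1)!.
betaIntegral : ∀ {L N} → (∀ m → 1 ≤ m → m ≤ N → m ∣ L) →
               ∀ b a → suc (a + b) ≤ N → suc (a + b) ! ∣ L * (a ! * b !)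
betaIntegral {L} {N} mult zero a a<N rewrite +-identityʳ a | *-identityʳ (a !) =
  *-monoˡ-∣ (a !) (mult (suc a) (s≤s z≤n) a<N)
betaIntegral {L} {N} mult (suc b) a 1+a+1+b≤N rewrite +-suc a b =
  ∣m+n∣m⇒∣n (subst (suc s ! ∣_) (sum L (a !) (b !) a b) whole) part
  where
  s = suc (a + b)
  -- This is xᵃ(1-x)ᵇ = xᵃ⁺¹(1-x)ᵇ + xᵃ(1-x)ᵇ⁺¹ under the integral; the last term is integral as a
  -- difference of two integral ones.
  sum : ∀ L x y a b → suc (suc (a + b)) * (L * (x * y)) ≡ L * ((x + a * x) * y) + L * (x * (y + b * y))
  sum = solve-∀
  whole : suc s ! ∣ suc s * (L * (a ! * b !))
  whole = *-monoʳ-∣ (suc s) (betaIntegral mult b a (≤-trans (n≤1+n s) 1+a+1+b≤N))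
  part : suc s ! ∣ L * (suc a ! * b !)
  part = betaIntegral mult b (suc a) 1+a+1+b≤N

-- In terms of the beta integral: ∫₀¹ (x(1-x))ⁿ dx ≤ 4⁻ⁿ. The induction step compares 4(n+1)² with
-- (2n+2)(2n+3).
4^n*n!²≤[2n+1]! : ∀ n → 4 ^ n * (n ! * n !) ≤ suc (n + n) !
4^n*n!²≤[2n+1]! zero = s≤s z≤n
4^n*n!²≤[2n+1]! (suc n) = begin
  4 * 4 ^ n * ((n ! + n * n !) * (n ! + n * n !))   ≡⟨ regroup (4 ^ n) (n !) n ⟩
  4 * (suc n * suc n) * (4 ^ n * (n ! * n !))       ≤⟨ *-mono-≤ factor (4^n*n!²≤[2n+1]! n) ⟩
  suc (suc s) * suc s * s !                         ≡⟨ *-assoc (suc (suc s)) (suc s) (s !) ⟩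
  suc (suc s) !                                     ≡⟨ cong (_! ∘ suc) (+-suc (suc n) n) ⟨
  suc (suc n + suc n) !                             ∎
  where
  open ≤-Reasoning
  s = suc (n + n)
  regroup : ∀ x y n → 4 * x * ((y + n * y) * (y + n * y)) ≡ 4 * (suc n * suc n) * (x * (y * y))
  regroup = solve-∀
  expand : ∀ n → suc (suc (suc (n + n))) * suc (suc (n + n)) ≡ 4 * (suc n * suc n) + 2 * suc n
  expand = solve-∀
  factor : 4 * (suc n * suc n) ≤ suc (suc s) * suc s
  factor = subst (4 * (suc n * suc n) ≤_) (sym (expand n)) (m≤m+n _ _)

-- L ∫₀¹ (x(1-x))ⁿ dx is a positive integer, hence at least 1, and the integral is at most 4⁻ⁿ; so
-- 4ⁿ ≤ L. The factorials reach only 2n+1; taking `N` = 2n+2 allows `N` to be a power of two later.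
chebyshev : ∀ n → 4 ^ n ≤ (suc n + suc n) ^ πf (suc n + suc n)
chebyshev n with smoothMultiple N (s≤s z≤n) N
  where N = suc n + suc n
... | L , 1≤L , L≤ , mult = ≤-trans (*-cancelʳ-≤ (4 ^ n) L (n ! * n !) core) L≤
  where
  open ≤-Reasoning
  instance _ = >-nonZero 1≤L
  instance _ = n !* n !≢0
  instance _ = m*n≢0 L (n ! * n !)
  mult′ : ∀ m → 1 ≤ m → m ≤ suc n + suc n → m ∣ L
  mult′ m 1≤m m≤N = mult m 1≤m m≤N λ q _ q∣m → ≤-trans (∣⇒≤ {{>-nonZero 1≤m}} q∣m) m≤N
  core : 4 ^ n * (n ! * n !) ≤ L * (n ! * n !)
  core = begin
    4 ^ n * (n ! * n !)   ≤⟨ 4^n*n!²≤[2n+1]! n ⟩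
    suc (n + n) !         ≤⟨ ∣⇒≤ (betaIntegral mult′ n n (s≤s (+-monoʳ-≤ n (n≤1+n n)))) ⟩
    L * (n ! * n !)       ∎

4g<2^g : ∀ k → 1 + 4 * (5 + k) ≤ 2 ^ (5 + k)
4g<2^g zero = ≤ᵇ⇒≤ 21 32 _
4g<2^g (suc k) = begin
  1 + 4 * (6 + k)                 ≡⟨ expand k ⟩
  (1 + 4 * (5 + k)) + 4           ≤⟨ +-monoʳ-≤ (1 + 4 * (5 + k)) (s≤s (s≤s (s≤s (s≤s z≤n)))) ⟩
  (1 + 4 * (5 + k)) + (1 + 4 * (5 + k))   ≤⟨ +-mono-≤ (4g<2^g k) (4g<2^g k) ⟩
  2 ^ (5 + k) + 2 ^ (5 + k)       ≡⟨ cong (2 ^ (5 + k) +_) (+-identityʳ _) ⟨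
  2 ^ (6 + k)                     ∎
  where
  open ≤-Reasoning
  expand : ∀ k → 1 + 4 * (6 + k) ≡ (1 + 4 * (5 + k)) + 4
  expand = solve-∀

-- With x = 2^(2g), the root is 2^g. If π(x) were at most 2·2^g, Chebyshev's bound would give x ≤ 2
-- + 4g·2^g, against 1 + 4g ≤ 2^g. The latter fails at g = 4, hence `5 ≤ g`.
2√<π : ∀ g → 5 ≤ g → 2 * 2 ^ g < πf (2 ^ (g + g))
2√<π g 5≤g = ≰⇒> λ π≤ → <⇒≱ contra (core π≤)
  where
  open ≤-Reasoning
  π = πf (2 ^ (g + g))
  instance _ = >-nonZero (≤-trans (s≤s z≤n) 5≤g)
  -- `n` is chosen so that 2n + 2 = 2 ^ (g + g).
  h = 2 ^ pred (g + g)
  n = pred h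
  instance _ = m^n≢0 2 (pred (g + g))
  instance _ = >-nonZero (≤-trans (≤-trans (s≤s z≤n) 5≤g) (m≤m+n g g))
  N≡ : suc n + suc n ≡ 2 ^ (g + g)
  N≡ = trans (cong (λ x → x + x) (suc-pred h))
      (trans (cong (h +_) (sym (+-identityʳ h))) (cong (2 ^_) (suc-pred (g + g))))
  exps : 2 * n ≤ (g + g) * π
  exps = ≮⇒≥ λ lt → <⇒≱ (^-monoʳ-< 2 ≤-refl lt) (begin
    2 ^ (2 * n)              ≡⟨ ^-*-assoc 2 2 n ⟨
    4 ^ n                    ≤⟨ subst (λ N → 4 ^ n ≤ N ^ πf N) N≡ (chebyshev n) ⟩
    (2 ^ (g + g)) ^ π        ≡⟨ ^-*-assoc 2 (g + g) π ⟩
    2 ^ ((g + g) * π)        ∎)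
  core : π ≤ 2 * 2 ^ g → 2 ^ g * 2 ^ g ≤ 2 + 4 * g * 2 ^ g
  core π≤ = begin
    2 ^ g * 2 ^ g                    ≡⟨ ^-distribˡ-+-* 2 g g ⟨
    2 ^ (g + g)                      ≡⟨ N≡ ⟨
    suc n + suc n                    ≡⟨ double n ⟩
    2 + 2 * n                        ≤⟨ +-monoʳ-≤ 2 exps ⟩
    2 + (g + g) * π                  ≤⟨ +-monoʳ-≤ 2 (*-monoʳ-≤ (g + g) π≤) ⟩
    2 + (g + g) * (2 * 2 ^ g)        ≡⟨ regroup g (2 ^ g) ⟩
    2 + 4 * g * 2 ^ g                ∎
    where
    double : ∀ n → suc n + suc n ≡ 2 + 2 * n
    double = solve-∀
    regroup : ∀ g x → 2 + (g + g) * (2 * x) ≡ 2 + 4 * g * x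
    regroup = solve-∀
  contra : 2 + 4 * g * 2 ^ g < 2 ^ g * 2 ^ g
  contra = begin-strict
    2 + 4 * g * 2 ^ g          <⟨ +-monoˡ-< (4 * g * 2 ^ g) (<-≤-trans (≤ᵇ⇒≤ 3 32 _) (^-monoʳ-≤ 2 5≤g)) ⟩
    (1 + 4 * g) * 2 ^ g        ≤⟨ *-monoˡ-≤ (2 ^ g) (subst (λ g → 1 + 4 * g ≤ 2 ^ g) (m+[n∸m]≡n 5≤g) (4g<2^g (g ∸ 5))) ⟩
    2 ^ g * 2 ^ g              ∎

-- The numbers 2^(2^j) among the natural numbers

-- For n ≥ 1 this characterises the powers of two by their divisors, a form that first-order
-- formulas can express without exponentiation.
NoOddDivisor : ℕ → Set
NoOddDivisor n = ∀ c d → c * d ≡ n → c ≡ 1 ⊎ 2 ∣ c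

noOddDivisor⇒2^ : ∀ n → 1 ≤ n → NoOddDivisor n → ∃[ b ] n ≡ 2 ^ b
noOddDivisor⇒2^ n = go n n ≤-refl
  where
  go : ∀ fuel n → n ≤ fuel → 1 ≤ n → NoOddDivisor n → ∃[ b ] n ≡ 2 ^ b
  go zero n n≤0 1≤n _ = ⊥-elim (<⇒≱ 1≤n n≤0)
  go (suc fuel) n n≤ 1≤n noOdd with noOdd n 1 (*-identityʳ n)
  ... | inj₁ n≡1 = 0 , n≡1
  ... | inj₂ (divides zero refl) = ⊥-elim (<-irrefl refl 1≤n)
  ... | inj₂ (divides h@(suc _) refl) with go fuel h (s≤s⁻¹ (<-≤-trans (m<m*n h 2 ≤-refl) n≤)) (s≤s z≤n) half
    where
    half : NoOddDivisor h
    half c d cd≡h = noOdd c (d * 2) (trans (sym (*-assoc c d 2)) (cong (_* 2) cd≡h))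
  ...   | b , h≡ = suc b , trans (cong (_* 2) h≡) (*-comm (2 ^ b) 2)

2^-noOddDivisor : ∀ b → NoOddDivisor (2 ^ b)
2^-noOddDivisor zero    c d cd≡1 = inj₁ (m*n≡1⇒m≡1 c d cd≡1)
2^-noOddDivisor (suc b) c d cd≡ with euclidsLemma c d prime[2] (subst (2 ∣_) (sym cd≡) (m∣m*n (2 ^ b)))
... | inj₁ 2∣c = inj₂ 2∣c
... | inj₂ (divides q refl) = 2^-noOddDivisor b c q (*-cancelˡ-≡ (c * q) (2 ^ b) 2 (trans (shuffle c q) cd≡))
  where
  shuffle : ∀ c q → 2 * (c * q) ≡ c * (q * 2)
  shuffle = solve-∀

2∣or2∣suc : ∀ n → 2 ∣ n ⊎ 2 ∣ suc n
2∣or2∣suc zero    = inj₁ (2 ∣0)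
2∣or2∣suc (suc n) with 2∣or2∣suc n
... | inj₁ 2∣n = inj₂ (∣m∣n⇒∣m+n ∣-refl 2∣n)
... | inj₂ 2∣1+n = inj₁ 2∣1+n

odd⇒1+2k : ∀ c → ¬ 2 ∣ c → ∃[ k ] c ≡ 1 + 2 * k
odd⇒1+2k zero    2∤0 = ⊥-elim (2∤0 (2 ∣0))
odd⇒1+2k (suc c) 2∤1+c with 2∣or2∣suc c
... | inj₁ (divides k c≡) = k , cong suc (trans c≡ (*-comm k 2))
... | inj₂ 2∣1+c = ⊥-elim (2∤1+c 2∣1+c)

2∤1+2k : ∀ k → ¬ 2 ∣ 1 + 2 * k
2∤1+2k k 2∣ with ∣1⇒≡1 (∣m+n∣m⇒∣n (subst (2 ∣_) (+-comm 1 (2 * k)) 2∣) (m∣m*n k))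
... | ()

-- x²(1 + x^(2k+1)) exceeds 1 + x^(2k+3) by x² - 1, a multiple of x + 1; `split` states this without
-- subtraction.
x+1∣x^odd+1 : ∀ x k → 1 + x ∣ 1 + x ^ (1 + 2 * k)
x+1∣x^odd+1 x zero    = ∣-reflexive (cong suc (sym (*-identityʳ x)))
x+1∣x^odd+1 x (suc k) = subst (λ e → 1 + x ∣ 1 + x ^ (1 + e)) (sym (2+2k k))
  (∣m+n∣m⇒∣n (subst (1 + x ∣_) (split x (x ^ (2 * k))) (∣m∣n⇒∣m+n (∣n⇒∣m*n (x * x) (x+1∣x^odd+1 x k)) ∣-refl)) (m∣m*n x))
  where
  2+2k : ∀ k → 2 * suc k ≡ 2 + 2 * k
  2+2k = solve-∀
  split : ∀ x y → x * x * (1 + x * y) + (1 + x) ≡ (1 + x) * x + (1 + x * (x * (x * y)))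
  split = solve-∀

pred-2^ : ∀ b → suc (pred (2 ^ b)) ≡ 2 ^ b
pred-2^ b = suc-pred (2 ^ b) {{m^n≢0 2 b}}

-- Modulo 2^a + 1 we have 2^a ≡ −1, so the exponent b can be lowered by a at the price of a sign.
module _ (a : ℕ) (1≤a : 1 ≤ a) where
  private
    M = 1 + 2 ^ a

    both : ∀ b → M ∣ 2 ^ b * M
    both b = n∣m*n (2 ^ b)

    minus : ∀ b → M ∣ 1 + 2 ^ (a + b) → M ∣ pred (2 ^ b)
    minus b M∣ = ∣m+n∣m⇒∣n (subst (M ∣_) eq (both b)) M∣
      where
      arith : ∀ x y → suc y * (1 + x) ≡ 1 + x * suc y + y
      arith = solve-∀
      eq : 2 ^ b * M ≡ 1 + 2 ^ (a + b) + pred (2 ^ b)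
      eq = trans (subst (λ B → B * M ≡ 1 + 2 ^ a * B + pred (2 ^ b)) (pred-2^ b) (arith (2 ^ a) (pred (2 ^ b))))
                 (cong (λ B → 1 + B + pred (2 ^ b)) (sym (^-distribˡ-+-* 2 a b)))

    plus : ∀ b → M ∣ pred (2 ^ (a + b)) → M ∣ 1 + 2 ^ b
    plus b M∣ = ∣m+n∣m⇒∣n (subst (M ∣_) eq (both b)) M∣
      where
      eq : 2 ^ b * M ≡ pred (2 ^ (a + b)) + (1 + 2 ^ b)
      eq = begin
        2 ^ b * (1 + 2 ^ a)                  ≡⟨ arith (2 ^ b) (2 ^ a) ⟩
        2 ^ a * 2 ^ b + 2 ^ b                ≡⟨ cong (_+ 2 ^ b) (^-distribˡ-+-* 2 a b) ⟨
        2 ^ (a + b) + 2 ^ b                  ≡⟨ cong (_+ 2 ^ b) (pred-2^ (a + b)) ⟨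
        suc (pred (2 ^ (a + b))) + 2 ^ b     ≡⟨ +-suc _ _ ⟨
        pred (2 ^ (a + b)) + (1 + 2 ^ b)     ∎
        where
        open ≡-Reasoning
        arith : ∀ x y → x * (1 + y) ≡ y * x + x
        arith = solve-∀

    -- Both claims go through one induction, since lowering `b` by `a` exchanges 2^b + 1 and 2^b -
    -- 1. For 0 < b < a both numbers are positive and below `M`. At b = 0 the number 2^b - 1 is 0,
    -- which gives the even multiple 0.
    descend : ∀ fuel b → b ≤ fuel →
              (M ∣ 1 + 2 ^ b → ∃[ k ] b ≡ a * (1 + 2 * k)) × (M ∣ pred (2 ^ b) → ∃[ k ] b ≡ a * (2 * k))
    descend fuel zero _ =
      (λ M∣2 → ⊥-elim (<⇒≱ (s≤s (^-monoʳ-< 2 ≤-refl 1≤a)) (∣⇒≤ M∣2))) , λ _ → 0 , sym (*-zeroʳ a)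
    descend (suc fuel) b@(suc b-1) b≤ with a ≤? b
    ... | no a≰b =
      (λ M∣ → ⊥-elim (<⇒≱ (s≤s 2^b<2^a) (∣⇒≤ M∣))) ,
      λ M∣ → ⊥-elim (<⇒≱ (s≤s (<⇒≤ (≤-<-trans (pred[n]≤n {2 ^ b}) 2^b<2^a)))
                          (∣⇒≤ {{>-nonZero (s≤s⁻¹ (subst (2 ≤_) (sym (pred-2^ b)) (*-monoʳ-≤ 2 (m^n>0 2 b-1))))}} M∣))
      where
      2^b<2^a : 2 ^ b < 2 ^ a
      2^b<2^a = ^-monoʳ-< 2 ≤-refl (≰⇒> a≰b)
    ... | yes a≤b with m≤n⇒∃[o]m+o≡n a≤b
    ...   | r , a+r≡b with descend fuel r (s≤s⁻¹ (<-≤-trans (subst (r <_) a+r≡b (+-monoˡ-≤ r 1≤a)) b≤))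
    ...     | viaPlus , viaMinus = oddCase , evenCase
      where
      oddCase : M ∣ 1 + 2 ^ b → ∃[ k ] b ≡ a * (1 + 2 * k)
      oddCase M∣ with viaMinus (minus r (subst (λ b → M ∣ 1 + 2 ^ b) (sym a+r≡b) M∣))
      ... | k , r≡ = k , trans (sym a+r≡b) (trans (cong (a +_) r≡) (arith a k))
        where
        arith : ∀ a k → a + a * (2 * k) ≡ a * (1 + 2 * k)
        arith = solve-∀
      evenCase : M ∣ pred (2 ^ b) → ∃[ k ] b ≡ a * (2 * k)
      evenCase M∣ with viaPlus (plus r (subst (λ b → M ∣ pred (2 ^ b)) (sym a+r≡b) M∣))
      ... | k , r≡ = suc k , trans (sym a+r≡b) (trans (cong (a +_) r≡) (arith a k))
        where
        arith : ∀ a k → a + a * (1 + 2 * k) ≡ a * (2 * suc k)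
        arith = solve-∀

  2^a+1∣2^b+1⇒odd : ∀ b → 1 + 2 ^ a ∣ 1 + 2 ^ b → ∃[ k ] b ≡ a * (1 + 2 * k)
  2^a+1∣2^b+1⇒odd b = proj₁ (descend b b ≤-refl)

-- The equation says (e + 1)(d + 1) = n + 1.
NoFermatFactor : ℕ → Set
NoFermatFactor n = ∀ e d → 2 ≤ e → 1 ≤ d → NoOddDivisor e → n ≢ e + (d * e + d)

-- A factor 2^a + 1 makes 2^j an odd multiple of `a`; the odd cofactor divides a power of two, so it
-- is 1. Then e = 2^a is all of `n`, which `1 ≤ d` excludes.
2^2^-noFermatFactor : ∀ j → NoFermatFactor (2 ^ 2 ^ j)
2^2^-noFermatFactor j e d 2≤e 1≤d noOdd n≡ with noOddDivisor⇒2^ e (<⇒≤ 2≤e) noOdd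
... | zero  , refl = <-irrefl refl 2≤e
... | a@(suc _) , refl with 2^a+1∣2^b+1⇒odd a (s≤s z≤n) (2 ^ j) (divides (suc d) (trans (cong suc n≡) (arith (2 ^ a) d)))
  where
  arith : ∀ e d → suc (e + (d * e + d)) ≡ suc d * (1 + e)
  arith = solve-∀
... | k , 2^j≡ with 2^-noOddDivisor j (1 + 2 * k) a (trans (*-comm (1 + 2 * k) a) (sym 2^j≡))
...   | inj₂ 2∣ = 2∤1+2k k 2∣
...   | inj₁ 1+2k≡1 = <-irrefl n≡ (begin-strict
    2 ^ 2 ^ j              ≡⟨ cong (2 ^_) (trans 2^j≡ (trans (cong (a *_) 1+2k≡1) (*-identityʳ a))) ⟩
    2 ^ a                  <⟨ m<m+n (2 ^ a) (≤-trans 1≤d (m≤n+m d _)) ⟩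
    2 ^ a + (d * 2 ^ a + d)    ∎)
  where open ≤-Reasoning

-- Write n = 2^b. An odd divisor c > 1 of `b`, with b = c * a, would make 2^a + 1 a proper factor of
-- n + 1. Hence `b` is itself a power of two.
noFermatFactor⇒2^2^ : ∀ n → 2 ≤ n → NoOddDivisor n → NoFermatFactor n → ∃[ j ] n ≡ 2 ^ 2 ^ j
noFermatFactor⇒2^2^ n 2≤n noOdd noFermat with noOddDivisor⇒2^ n (<⇒≤ 2≤n) noOdd
... | zero , refl = ⊥-elim (<-irrefl refl 2≤n)
... | b@(suc _) , refl with noOddDivisor⇒2^ b (s≤s z≤n) noOdd-b
  where
  noOdd-b : NoOddDivisor b
  noOdd-b c a ca≡b with 2 ∣? c
  ... | yes 2∣c = inj₂ 2∣c
  ... | no  2∤c with odd⇒1+2k c 2∤c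
  ...   | zero  , c≡1 = inj₁ c≡1
  ...   | k@(suc _) , refl = ⊥-elim (factor a ca≡b)
    where
    factor : ∀ a → (1 + 2 * k) * a ≡ b → ⊥
    factor zero    0≡b = 0≢1+n (trans (sym (*-zeroʳ (1 + 2 * k))) 0≡b)
    factor a@(suc _) ca≡b with x+1∣x^odd+1 (2 ^ a) k
    ... | divides q eq with trans (cong suc (sym (trans (^-*-assoc 2 a (1 + 2 * k)) (cong (2 ^_) (trans (*-comm a (1 + 2 * k)) ca≡b))))) eq
    factor a@(suc _) ca≡b | divides zero eq | ()
    factor a@(suc _) ca≡b | divides 1 eq | 1+2^b≡ =
      <-irrefl (trans (sym (+-identityʳ (2 ^ a))) (sym (suc-injective 1+2^b≡)))
               (^-monoʳ-< 2 ≤-refl (subst (a <_) ca≡b (m<m+n a z<s)))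
    factor a@(suc a-1) ca≡b | divides (suc d@(suc _)) eq | 1+2^b≡ =
      noFermat (2 ^ a) d (*-monoʳ-≤ 2 (m^n>0 2 a-1)) (s≤s z≤n) (2^-noOddDivisor a)
        (suc-injective (trans 1+2^b≡ (arith (2 ^ a) d)))
      where
      arith : ∀ e d → suc d * (1 + e) ≡ suc (e + (d * e + d))
      arith = solve-∀
... | j , b≡ = j , cong (2 ^_) b≡

-- Semantics of first-order formulas

T-not⁻ : ∀ {b} → T (not b) → ¬ T b
T-not⁻ {false} _ ()

T-not⁺ : ∀ {b} → ¬ T b → T (not b)
T-not⁺ {false} _ = tt
T-not⁺ {true}  ¬t = ¬t tt

T-⇒⁻ : ∀ {a b} → T (not a ∨ b) → T a → T b
T-⇒⁻ {true} t _ = t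

T-⇒⁺ : ∀ {a b} → (T a → T b) → T (not a ∨ b)
T-⇒⁺ {true}  f = f tt
T-⇒⁺ {false} f = tt

all⁻ : ∀ {P : ℕ → Bool} xs → T (all P xs) → ∀ {x} → x ∈ xs → T (P x)
all⁻ (x ∷ xs) t (here refl) = proj₁ (Equivalence.to T-∧ t)
all⁻ (x ∷ xs) t (there x∈)  = all⁻ xs (proj₂ (Equivalence.to T-∧ t)) x∈

all⁺ : ∀ {P : ℕ → Bool} xs → (∀ {x} → x ∈ xs → T (P x)) → T (all P xs)
all⁺ []       _ = tt
all⁺ (x ∷ xs) f = Equivalence.from T-∧ (f (here refl) , all⁺ xs (f ∘ there))

module _ (k : ℕ) where
  private
    m = suc k

  -- Only the first-order constructors get a propositional reading; the last clause leaves modular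
  -- and majority quantifiers Boolean. This is enough because `θ` has its sole modular quantifier in
  -- front and its count is computed separately.
  ⟦_⟧ : ∀ {n} → Formula n → Vec ℕ n → Set
  ⟦ s ≐ t ⟧  ρ = evalT k ρ s ≡ evalT k ρ t
  ⟦ s ≺ t ⟧  ρ = evalT k ρ s < evalT k ρ t
  ⟦ ¬f φ ⟧   ρ = ¬ ⟦ φ ⟧ ρ
  ⟦ φ ∧f ψ ⟧ ρ = ⟦ φ ⟧ ρ × ⟦ ψ ⟧ ρ
  ⟦ φ ∨f ψ ⟧ ρ = ⟦ φ ⟧ ρ ⊎ ⟦ ψ ⟧ ρ
  ⟦ φ ⇒f ψ ⟧ ρ = ⟦ φ ⟧ ρ → ⟦ ψ ⟧ ρ
  ⟦ ∃f φ ⟧   ρ = ∃[ z ] (z < m × ⟦ φ ⟧ (z ∷ ρ))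
  ⟦ ∀f φ ⟧   ρ = ∀ z → z < m → ⟦ φ ⟧ (z ∷ ρ)
  ⟦ φ ⟧      ρ = T (eval k ρ φ)

  sound    : ∀ {n} (φ : Formula n) ρ → T (eval k ρ φ) → ⟦ φ ⟧ ρ
  complete : ∀ {n} (φ : Formula n) ρ → ⟦ φ ⟧ ρ → T (eval k ρ φ)

  sound (s ≐ t)  ρ t≡ = ≡ᵇ⇒≡ _ _ t≡
  sound (s ≺ t)  ρ t< = <ᵇ⇒< _ _ t<
  sound ⊤f       ρ tr = tr
  sound ⊥f       ρ tr = tr
  sound (¬f φ)   ρ tr = T-not⁻ tr ∘ complete φ ρ
  sound (φ ∧f ψ) ρ tr = Product.map (sound φ ρ) (sound ψ ρ) (Equivalence.to T-∧ tr)
  sound (φ ∨f ψ) ρ tr = Sum.map (sound φ ρ) (sound ψ ρ) (Equivalence.to T-∨ tr)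
  sound (φ ⇒f ψ) ρ tr = sound ψ ρ ∘ T-⇒⁻ tr ∘ complete φ ρ
  sound (∃f φ)   ρ tr with find (any⁻ (λ z → eval k (z ∷ ρ) φ) (upTo m) tr)
  ... | z , z∈ , t = z , ∈-upTo⁻ z∈ , sound φ (z ∷ ρ) t
  sound (∀f φ)   ρ tr z z<m = sound φ (z ∷ ρ) (all⁻ (upTo m) tr (∈-upTo⁺ z<m))
  sound (∃mod r q r<q φ) ρ tr = tr
  sound (Maj φ)  ρ tr = tr

  complete (s ≐ t)  ρ eq = ≡⇒≡ᵇ _ _ eq
  complete (s ≺ t)  ρ lt = <⇒<ᵇ lt
  complete ⊤f       ρ tr = tr
  complete ⊥f       ρ tr = tr
  complete (¬f φ)   ρ ¬p = T-not⁺ (¬p ∘ sound φ ρ)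
  complete (φ ∧f ψ) ρ pq = Equivalence.from T-∧ (Product.map (complete φ ρ) (complete ψ ρ) pq)
  complete (φ ∨f ψ) ρ pq = Equivalence.from T-∨ (Sum.map (complete φ ρ) (complete ψ ρ) pq)
  complete (φ ⇒f ψ) ρ pq = T-⇒⁺ (complete ψ ρ ∘ pq ∘ sound φ ρ)
  complete (∃f φ)   ρ (z , z<m , p) = any⁺ (λ z → eval k (z ∷ ρ) φ) (lose (∈-upTo⁺ z<m) (complete φ (z ∷ ρ) p))
  complete (∀f φ)   ρ p = all⁺ (upTo m) λ {z} z∈ → complete φ (z ∷ ρ) (p z (∈-upTo⁻ z∈))
  complete (∃mod r q r<q φ) ρ tr = tr
  complete (Maj φ)  ρ tr = tr

-- Formulas for the numbers 2^(2^j) with square below m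

-- Says z * z < m without naming m: the products z * c with c ≤ z are not reduced modulo m.
smallSquare : Formula 1
smallSquare = ∀f ((c ≺ z) ⇒f ((z ⊛ c) ≺ ((z ⊛ c) ⊕ z)))
  where
  c z : Term 2
  c = var zero
  z = var (suc zero)

-- There is no constant 1: c = 1 is expressed by c * c = c, where 0 is excluded as a divisor of x.
noOddDivisor : ∀ {n} → Fin n → Formula n
noOddDivisor x = ∀f (∀f ((¬f (X ≺ c)) ⇒f ((¬f (X ≺ d)) ⇒f (((c ⊛ d) ≐ X) ⇒f
  (((c ⊛ c) ≐ c) ∨f ∃f ((¬f (c′ ≺ h)) ∧f ((h ⊕ h) ≐ c′)))))))
  where
  X = var (suc (suc x))
  d = var zero
  c = var (suc zero)
  h = var zero
  c′ = var (suc (suc zero))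

-- The 1 on both sides of (e + 1)(d + 1) = z + 1 is cancelled, and `e ≺ (e ⊛ e)` stands for 2 ≤ e.
-- The guards `e ≺ z` and `d ≺ z` give (e + 1)(d + 1) ≤ z², so that nothing is reduced once z² < m.
noFermatFactor : Formula 1
noFermatFactor = ∀f (∀f ((e ≺ z) ⇒f ((d ≺ z) ⇒f ((e ≺ (e ⊛ e)) ⇒f ((zer ≺ d) ⇒f
  (noOddDivisor (suc zero) ⇒f (¬f (z ≐ (e ⊕ ((d ⊛ e) ⊕ d))))))))))
  where
  d e z : Term 3
  d = var zero
  e = var (suc zero)
  z = var (suc (suc zero))

-- `smallSquare` makes the arithmetic of the other conjuncts exact; the second conjunct then says 2
-- ≤ z.
smallTower : Formula 1
smallTower = smallSquare ∧f (((var zero) ≺ (var zero ⊛ var zero)) ∧f (noOddDivisor zero ∧f noFermatFactor))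

n<n²⇒2≤n : ∀ n → n < n * n → 2 ≤ n
n<n²⇒2≤n 1 (s≤s ())
n<n²⇒2≤n (suc (suc n)) _ = s≤s (s≤s z≤n)

-- Correctness of the formulas in Z_m

module _ (k : ℕ) where
  private
    m = suc k

  -- At the first `c` where z * c + z reaches `m`, its residue is z * c + z - m ≤ z * c because z <
  -- m, so the formula fails there.
  smallSquare⇒ : ∀ z → z < m → ⟦ k ⟧ smallSquare (z ∷ []) → z * z < m
  smallSquare⇒ z z<m noWrap = go z ≤-refl
    where
    go : ∀ c → c ≤ z → z * c < m
    go zero    _   = subst (_< m) (sym (*-zeroʳ z)) z<s
    go (suc c) c<z = ≰⇒> λ m≤ → <⇒≱ increase (wrapped m≤)
      where
      zc<m : z * c < m
      zc<m = go c (<⇒≤ c<z)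
      increase : z * c < (z * c + z) % m
      increase = subst (λ x → x < (x + z) % m) (m<n⇒m%n≡m zc<m) (noWrap c (<-trans c<z z<m) c<z)
      wrapped : m ≤ z * suc c → (z * c + z) % m ≤ z * c
      wrapped m≤ = begin
        (z * c + z) % m              ≡⟨ cong (_% m) (m∸n+n≡m m≤′) ⟨
        (z * c + z ∸ m + m) % m      ≡⟨ [m+n]%n≡m%n (z * c + z ∸ m) m ⟩
        (z * c + z ∸ m) % m          ≤⟨ m%n≤m (z * c + z ∸ m) m ⟩
        z * c + z ∸ m                ≤⟨ ∸-monoʳ-≤ (z * c + z) (<⇒≤ z<m) ⟩
        z * c + z ∸ z                ≡⟨ m+n∸n≡m (z * c) z ⟩
        z * c                        ∎
        where
        open ≤-Reasoning
        m≤′ : m ≤ z * c + z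
        m≤′ = subst (m ≤_) (trans (*-suc z c) (+-comm z (z * c))) m≤

  module _ {z : ℕ} (2≤z : 2 ≤ z) (z²<m : z * z < m) where

    -- The order guards in the formulas keep every sum and product at most z², so this removes all
    -- reductions modulo `m`.
    exact : ∀ {x} → x ≤ z * z → x % m ≡ x
    exact x≤z² = m<n⇒m%n≡m (≤-<-trans x≤z² z²<m)

    z<m : z < m
    z<m = ≤-<-trans (m≤m*n z z {{>-nonZero (<⇒≤ 2≤z)}}) z²<m

    2z≤z² : z + z ≤ z * z
    2z≤z² = subst (_≤ z * z) (cong (z +_) (+-identityʳ z)) (*-monoˡ-≤ z 2≤z)

    smallSquare⇐ : ⟦ k ⟧ smallSquare (z ∷ [])
    smallSquare⇐ c c<m c<z
      rewrite exact (*-monoʳ-≤ z (<⇒≤ c<z))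
            | exact (subst (_≤ z * z) (trans (*-suc z c) (+-comm z (z * c))) (*-monoʳ-≤ z c<z)) =
      m<m+n (z * c) (<⇒≤ 2≤z)

    module _ {n} (ρ : Vec ℕ n) (x : Fin n) (n≥1 : 1 ≤ lookup ρ x) (n≤z : lookup ρ x ≤ z) where
      private
        N = lookup ρ x
        instance _ = >-nonZero n≥1

      noOddDivisor⇒ : ⟦ k ⟧ (noOddDivisor x) ρ → NoOddDivisor N
      noOddDivisor⇒ noOdd c d cd≡N = interpret
        (noOdd c (≤-<-trans c≤z z<m) d (≤-<-trans (≤-trans d≤N n≤z) z<m) (≤⇒≯ c≤N) (≤⇒≯ d≤N)
               (trans (cong (_% m) cd≡N) (m<n⇒m%n≡m (≤-<-trans n≤z z<m))))
        where
        c≤N : c ≤ N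
        c≤N = ∣⇒≤ (divides d (trans (sym cd≡N) (*-comm c d)))
        d≤N : d ≤ N
        d≤N = ∣⇒≤ (divides c (sym cd≡N))
        c≤z : c ≤ z
        c≤z = ≤-trans c≤N n≤z
        instance _ = ≢-nonZero {c} λ { refl → <-irrefl cd≡N n≥1 }
        interpret : ((c * c) % m ≡ c) ⊎ (∃[ h ] (h < m × (¬ c < h) × (h + h) % m ≡ c)) → c ≡ 1 ⊎ 2 ∣ c
        interpret (inj₁ cc≡c) =
          inj₁ (c*c≡c⇒c≡1 (trans (sym (exact (*-mono-≤ c≤z c≤z))) cc≡c))
          where
          c*c≡c⇒c≡1 : c * c ≡ c → c ≡ 1
          c*c≡c⇒c≡1 eq = *-cancelˡ-≡ c 1 c (trans eq (sym (*-identityʳ c)))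
        interpret (inj₂ (h , _ , c≮h , hh≡c)) =
          inj₂ (divides h (trans (sym (trans (sym (exact (≤-trans (+-mono-≤ h≤z h≤z) 2z≤z²))) hh≡c)) (h+h h)))
          where
          h≤z : h ≤ z
          h≤z = ≤-trans (≮⇒≥ c≮h) c≤z
          h+h : ∀ h → h + h ≡ h * 2
          h+h = solve-∀

      noOddDivisor⇐ : NoOddDivisor N → ⟦ k ⟧ (noOddDivisor x) ρ
      noOddDivisor⇐ noOdd c c<m d d<m N≮c N≮d cd≡N
        with noOdd c d (trans (sym (exact (*-mono-≤ (≤-trans (≮⇒≥ N≮c) n≤z) (≤-trans (≮⇒≥ N≮d) n≤z)))) cd≡N)
      ... | inj₁ refl = inj₁ (m<n⇒m%n≡m c<m)
      ... | inj₂ (divides h refl) = inj₂ (h , ≤-<-trans h≤c c<m , ≤⇒≯ h≤c ,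
              trans (cong (_% m) (h+h h)) (m<n⇒m%n≡m c<m))
        where
        h≤c : h ≤ h * 2
        h≤c = m≤m*n h 2
        h+h : ∀ h → h + h ≡ h * 2
        h+h = solve-∀

    exactProduct : ∀ {e d} → e < z → d < z → (e + ((d * e) % m + d) % m) % m ≡ e + (d * e + d)
    exactProduct {e} {d} e<z d<z = begin
      (e + ((d * e) % m + d) % m) % m   ≡⟨ cong (λ x → (e + (x + d) % m) % m) (exact (≤-trans (m≤m+n (d * e) d) inner)) ⟩
      (e + (d * e + d) % m) % m         ≡⟨ cong (λ x → (e + x) % m) (exact inner) ⟩
      (e + (d * e + d)) % m             ≡⟨ exact outer ⟩
      e + (d * e + d)                   ∎
      where
      open ≡-Reasoning
      arith : ∀ e d → suc d * suc e ≡ suc (e + (d * e + d))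
      arith = solve-∀
      outer : e + (d * e + d) ≤ z * z
      outer = ≤-trans (n≤1+n _) (subst (_≤ z * z) (arith e d) (*-mono-≤ d<z e<z))
      inner : d * e + d ≤ z * z
      inner = ≤-trans (m≤n+m _ e) outer

    noFermatFactor⇒ : ⟦ k ⟧ noFermatFactor (z ∷ []) → NoFermatFactor z
    noFermatFactor⇒ noFermat e d 2≤e 1≤d noOdd z≡ =
      noFermat e (<-trans e<z z<m) d (<-trans d<z z<m) e<z d<z
        (subst (e <_) (sym (exact (*-mono-≤ (<⇒≤ e<z) (<⇒≤ e<z)))) (m<m*n e e 2≤e))
        1≤d
        (noOddDivisor⇐ (d ∷ e ∷ z ∷ []) (suc zero) (<⇒≤ 2≤e) (<⇒≤ e<z) noOdd)
        (trans z≡ (sym (exactProduct e<z d<z)))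
      where
      instance _ = >-nonZero (<⇒≤ 2≤e)
      instance _ = >-nonZero 1≤d
      e<z : e < z
      e<z = subst (e <_) (sym z≡) (m<m+n e (≤-trans 1≤d (m≤n+m d _)))
      d<z : d < z
      d<z = subst (d <_) (sym z≡) (≤-trans (m<n+m d (m*n>0 d e)) (m≤n+m _ e))
        where
        m*n>0 : ∀ d e .{{_ : NonZero d}} .{{_ : NonZero e}} → d * e > 0
        m*n>0 d e = >-nonZero⁻¹ (d * e) {{m*n≢0 d e}}

    noFermatFactor⇐ : NoFermatFactor z → ⟦ k ⟧ noFermatFactor (z ∷ [])
    noFermatFactor⇐ noFermat e e<m d d<m e<z d<z e<ee 0<d noOdd z≡ =
      noFermat e d 2≤e 0<d (noOddDivisor⇒ (d ∷ e ∷ z ∷ []) (suc zero) (<⇒≤ 2≤e) (<⇒≤ e<z) noOdd)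
        (trans z≡ (exactProduct e<z d<z))
      where
      2≤e : 2 ≤ e
      2≤e = n<n²⇒2≤n e (subst (e <_) (exact (*-mono-≤ (<⇒≤ e<z) (<⇒≤ e<z))) e<ee)

  smallTower⇒ : ∀ z → z < m → ⟦ k ⟧ smallTower (z ∷ []) → z * z < m × ∃[ j ] z ≡ 2 ^ 2 ^ j
  smallTower⇒ z z<m (small , z<zz , noOdd , noFermat) =
    z²<m , noFermatFactor⇒2^2^ z 2≤z (noOddDivisor⇒ 2≤z z²<m (z ∷ []) zero (<⇒≤ 2≤z) ≤-refl noOdd)
             (noFermatFactor⇒ 2≤z z²<m noFermat)
    where
    z²<m : z * z < m
    z²<m = smallSquare⇒ z z<m small
    2≤z : 2 ≤ z
    2≤z = n<n²⇒2≤n z (subst (z <_) (m<n⇒m%n≡m z²<m) z<zz)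

  smallTower⇐ : ∀ j → 2 ^ 2 ^ j * 2 ^ 2 ^ j < m → ⟦ k ⟧ smallTower (2 ^ 2 ^ j ∷ [])
  smallTower⇐ j z²<m =
    smallSquare⇐ 2≤z z²<m ,
    subst (z <_) (sym (m<n⇒m%n≡m z²<m)) (m<m*n z z {{>-nonZero (<⇒≤ 2≤z)}} 2≤z) ,
    noOddDivisor⇐ 2≤z z²<m (z ∷ []) zero (<⇒≤ 2≤z) ≤-refl (2^-noOddDivisor (2 ^ j)) ,
    noFermatFactor⇐ 2≤z z²<m (2^2^-noFermatFactor j)
    where
    z = 2 ^ 2 ^ j
    2≤z : 2 ≤ z
    2≤z = ^-monoʳ-≤ 2 (m^n>0 2 j)

-- Blocks of primes

tower : ℕ → ℕ
tower j = 2 ^ 2 ^ j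

tower-suc : ∀ j → tower (suc j) ≡ tower j * tower j
tower-suc j = trans (cong (λ e → 2 ^ (2 ^ j + e)) (+-identityʳ (2 ^ j))) (^-distribˡ-+-* 2 (2 ^ j) (2 ^ j))

tower-mono-< : ∀ {i j} → i < j → tower i < tower j
tower-mono-< i<j = ^-monoʳ-< 2 ≤-refl (^-monoʳ-< 2 ≤-refl i<j)

tower-mono-≤ : ∀ {i j} → i ≤ j → tower i ≤ tower j
tower-mono-≤ i≤j = ^-monoʳ-≤ 2 (^-monoʳ-≤ 2 i≤j)

tower-cancel-< : ∀ {i j} → tower i < tower j → i < j
tower-cancel-< ti<tj = ≰⇒> λ j≤i → <⇒≱ ti<tj (tower-mono-≤ j≤i)

n<tower : ∀ n → n < tower n
n<tower n = <-trans (n<2^n n) (n<2^n (2 ^ n))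

module _ (k J : ℕ) (above : tower J < suc k) (below : suc k ≤ tower (suc J)) where
  private
    m = suc k

    P : ℕ → Bool
    P z = eval k (z ∷ []) smallTower

    P-false : ∀ {z} → z < m → (∀ j → z ≡ tower j → z * z < m → ⊥) → P z ≡ false
    P-false {z} z<m none with P z in eq
    ... | false = refl
    ... | true with smallTower⇒ k z z<m (sound k smallTower (z ∷ []) (Equivalence.from T-≡ eq))
    ...   | z²<m , j , z≡ = ⊥-elim (none j z≡ z²<m)

    P-true : ∀ {j} → j < J → P (tower j) ≡ true
    P-true {j} j<J = Equivalence.to T-≡ (complete k smallTower (tower j ∷ []) (smallTower⇐ k j
      (subst (_< m) (tower-suc j) (≤-<-trans (tower-mono-≤ j<J) above))))

    -- The bound is exclusive: `tower 0` to `tower (j - 1)` are counted. Nothing lies below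
    -- `tower 0` = 2, and nothing strictly between consecutive towers.
    tally-tower : ∀ j → j ≤ J → tally P (tower j) ≡ j
    tally-tower zero _ = tally-const P z≤n λ x _ x<2 →
      P-false (<-trans x<2 (≤-<-trans (tower-mono-≤ (z≤n {J})) above))
              λ { i refl _ → <⇒≱ x<2 (tower-mono-≤ (z≤n {i})) }
    tally-tower (suc j) j<J = begin
      tally P (tower (suc j))   ≡⟨ tally-const P (tower-mono-< (n<1+n j)) gap ⟩
      tally P (suc (tower j))   ≡⟨ tally-true P (tower j) (P-true j<J) ⟩
      suc (tally P (tower j))   ≡⟨ cong suc (tally-tower j (<⇒≤ j<J)) ⟩
      suc j                     ∎
      where
      open ≡-Reasoning
      gap : ∀ x → tower j < x → x < tower (suc j) → P x ≡ false
      gap x lower upper = P-false (<-trans upper (≤-<-trans (tower-mono-≤ j<J) above))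
        λ { i refl _ → <⇒≱ (tower-cancel-< {j} {i} lower) (s≤s⁻¹ (tower-cancel-< {i} {suc j} upper)) }

  -- `tower J` is below `m` but not counted: its square is `tower (suc J)`, which is at least `m`.
  count-smallTower : count k P ≡ J
  count-smallTower = trans (tally-const P (<⇒≤ above) beyond) (tally-tower J ≤-refl)
    where
    beyond : ∀ x → tower J ≤ x → x < m → P x ≡ false
    beyond x TJ≤x x<m = P-false x<m λ { i refl x²<m →
      <⇒≱ (tower-mono-< (s≤s⁻¹ (tower-cancel-< {suc i} {suc J}
             (subst (_< tower (suc J)) (sym (tower-suc i)) (<-≤-trans x²<m below))))) TJ≤x }

-- The spectrum of θ and its oscillation

θ : Sentence
θ = ∃mod 0 3 (s≤s z≤n) smallTower

Sat-θ : ∀ J {p} → tower J < p → p ≤ tower (suc J) → Sat p θ ≡ ((J % 3) ≡ᵇ 0)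
Sat-θ J {suc k} above below = cong (λ c → (c % 3) ≡ᵇ 0) (count-smallTower k J above below)

-- Chebyshev's bound with g = 2^J; `3 ≤ J` gives g ≥ 8, and J = 2 would give only 4 where 5 is
-- needed.
2tower<π : ∀ J → 3 ≤ J → 2 * tower J < πf (tower (suc J))
2tower<π J 3≤J = subst (λ e → 2 * tower J < πf (2 ^ e)) (cong (2 ^ J +_) (sym (+-identityʳ (2 ^ J))))
  (2√<π (2 ^ J) (≤-trans (≤ᵇ⇒≤ 5 8 _) (^-monoʳ-≤ 2 3≤J)))

2≤2tower : ∀ J → 2 ≤ 2 * tower J
2≤2tower J = *-monoʳ-≤ 2 (m^n>0 2 (2 ^ J))

-- Blocks 1 + 3t and 2 + 3t are both skipped, so up to their end the spectrum has at most
-- `tower (1 + t * 3)` elements. The square of this number is `tower J` < π(n), so the ratio of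
-- logarithms is below 1/2.
sparse : ∀ N → ∃[ n ] (N ≤ n × 2 ≤ πf n × πSp θ n ^ 2 < πf n ^ 1)
sparse N = n , N≤n , ≤-trans (2≤2tower J) (<⇒≤ π>) , (begin-strict
    πSp θ n ^ 2                ≤⟨ ^-monoˡ-≤ 2 πS≤ ⟩
    tower (1 + t * 3) ^ 2      ≡⟨ cong (tower (1 + t * 3) *_) (*-identityʳ (tower (1 + t * 3))) ⟩
    tower (1 + t * 3) * tower (1 + t * 3)   ≡⟨ tower-suc (1 + t * 3) ⟨
    tower J                    ≤⟨ m≤m+n _ _ ⟩
    2 * tower J                <⟨ π> ⟩
    πf n                       ≡⟨ ^-identityʳ (πf n) ⟨
    πf n ^ 1                   ∎)
  where
  open ≤-Reasoning
  -- Taking the successor ensures both N ≤ n and 3 ≤ J.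
  t = suc N
  J = 2 + t * 3
  n = tower (suc J)
  N≤n : N ≤ n
  N≤n = ≤-trans (≤-trans (≤-trans (n≤1+n N) (m≤m*n t 3)) (m≤n+m _ 3)) (<⇒≤ (n<tower (suc J)))
  π> : 2 * tower J < πf n
  π> = 2tower<π J (≤-trans (m≤n+m 3 (N * 3 + 2)) (≤-reflexive (arith N)))
    where
    arith : ∀ N → N * 3 + 2 + 3 ≡ 2 + suc N * 3
    arith = solve-∀
  outside : ∀ x → suc (tower (1 + t * 3)) ≤ x → x < suc n → inSp θ x ≡ false
  outside x lower upper with x ≤? tower J
  ... | yes x≤ = trans (cong (isPrime x ∧_) (trans (Sat-θ (1 + t * 3) lower x≤) (cong (_≡ᵇ 0) ([m+kn]%n≡m%n 1 t 3))))
                       (∧-zeroʳ (isPrime x))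
  ... | no  x≰ = trans (cong (isPrime x ∧_) (trans (Sat-θ J (≰⇒> x≰) (s≤s⁻¹ upper)) (cong (_≡ᵇ 0) ([m+kn]%n≡m%n 2 t 3))))
                       (∧-zeroʳ (isPrime x))
  πS≤ : πSp θ n ≤ tower (1 + t * 3)
  πS≤ = subst (_≤ tower (1 + t * 3))
    (sym (tally-const (inSp θ) (s≤s (tower-mono-≤ {1 + t * 3} {suc J} (≤-trans (n≤1+n _) (n≤1+n _)))) outside))
    (tally≤ (inSp θ) (tower (1 + t * 3)) refl)

-- Here `n` ends the selected block 3t. The primes missing from the spectrum are at most `tower J`,
-- less than half of π(n). The exponent 3/4 absorbs the factor 2: π³ < 8 πS³ ≤ πS⁴ as soon as πS ≥
-- 8.
dense : ∀ N → ∃[ n ] (N ≤ n × 2 ≤ πf n × πf n ^ 3 < πSp θ n ^ 4)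
dense N = n , N≤n , ≤-trans (2≤2tower J) (<⇒≤ π>) , (begin-strict
    πf n ^ 3             <⟨ ^-monoˡ-< 3 π<2πS ⟩
    (2 * πS) ^ 3         ≡⟨ cube πS ⟩
    8 * πS ^ 3           ≤⟨ *-monoˡ-≤ (πS ^ 3) 8≤πS ⟩
    πS ^ 4               ∎)
  where
  open ≤-Reasoning
  t = suc N
  J = t * 3
  n = tower (suc J)
  πS = πSp θ n
  3≤J : 3 ≤ J
  3≤J = m≤m+n 3 (N * 3)
  N≤n : N ≤ n
  N≤n = ≤-trans (≤-trans (≤-trans (n≤1+n N) (m≤m*n t 3)) (n≤1+n _)) (<⇒≤ (n<tower (suc J)))
  π> : 2 * tower J < πf n
  π> = 2tower<π J 3≤J
  inside : ∀ x → suc (tower J) ≤ x → x < suc n → isPrime x ≡ true → inSp θ x ≡ true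
  inside x lower upper pr = cong₂ _∧_ pr (trans (Sat-θ J lower (s≤s⁻¹ upper)) (cong (_≡ᵇ 0) (m*n%n≡0 t 3)))
  π≤ : πf n ≤ πS + tower J
  π≤ = ≤-trans (tally-⊆ isPrime (inSp θ) (s≤s (tower-mono-≤ (n≤1+n J))) inside)
               (+-monoʳ-≤ πS (tally≤ isPrime (tower J) refl))
  tower<πS : tower J < πS
  tower<πS = +-cancelʳ-< (tower J) (tower J) πS
    (<-≤-trans (subst (_< πf n) (cong (tower J +_) (+-identityʳ (tower J))) π>) π≤)
  π<2πS : πf n < 2 * πS
  π<2πS = ≤-<-trans π≤ (subst (πS + tower J <_) (cong (πS +_) (sym (+-identityʳ πS))) (+-monoʳ-< πS tower<πS))
  8≤πS : 8 ≤ πS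
  8≤πS = ≤-trans (≤-trans (^-monoʳ-≤ 2 {3} 3≤2^J) (≤-refl {tower J})) (<⇒≤ tower<πS)
    where
    3≤2^J : 3 ≤ 2 ^ J
    3≤2^J = ≤-trans 3≤J (<⇒≤ (n<2^n J))
  cube : ∀ x → 2 * x * (2 * x * (2 * x * 1)) ≡ 8 * (x * (x * (x * 1)))
  cube = solve-∀

theorem8p3 : ∃[ θ ] NoExponentialDensity θ
-- The sequence is infinitely often below 1/2 and infinitely often above 3/4; the comparison is 1 *
-- 4 < 3 * 2.
theorem8p3 = θ , 1 , 2 , 3 , 4 , s≤s z≤n , s≤s z≤n , ≤ᵇ⇒≤ 5 6 _ , sparse , dense
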